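{- Let $M$ be a matroid, and let $N$ be a matroid whose ground set is the set of circuits of $M$, such that: if $\mathcal{C}'$ is a perfect collection of circuits of $M$, then each circuit $C'$ of $M$ contained in $\bigcup_{C\in\mathcal{C}'}C$ satisfies $C'\in\mathrm{cl}_N(\mathcal{C}')$. Then the function $r_{M^N}$ defined, for all $X\subseteq E(M)$, by $$r_{M^N}(X)=r_M(X)+r_N(\{C\colon C \text{ is a circuit of } M|X\})$$ is the rank function of a matroid $M^N$ on $E(M)$ which is a rank-$r(N)$ lift of $M$.
   Context: Matroids are finite; $r_M$ denotes the rank function of $M$, $r(M)$ its rank, $\mathrm{cl}_N$ the closure operator of $N$. A collection $\mathcal{C}'$ of circuits of $M$ is perfect if $|\bigcup_{C\in\mathcal{C}'}C|-r_M(\bigcup_{C\in\mathcal{C}'}C)=|\mathcal{C}'|$, and no circuit in $\mathcal{C}'$ is contained in the union of the others. A matroid $K$ is a lift of a matroid $M$ if there is a matroid $P$ and a subset $X$ of $E(P)$ so that $P\setminus X=K$ (deletion) and $P/X=M$ (contraction). If $r(K)-r(M)=k$, then $K$ is a rank-$k$ lift of $M$. -}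

module Defs where

open import Data.Nat using (ℕ; zero; suc; _+_; _∸_; _≤_; z≤n; s≤s; _≟_)
open import Data.Nat.Properties
  using (≤-trans; ≤-reflexive; m≤m+n; n≤1+n; ∸-monoˡ-≤; +-monoˡ-≤;
         +-mono-≤; +-comm; m∸n+n≡m; m≤n+o⇒m∸n≤o; +-cancelʳ-≤;
         module ≤-Reasoning)
open import Data.Nat.Solver using (module +-*-Solver)
open import Data.Bool using (true)
open import Data.Fin using (Fin; zero; suc)
import Data.Fin.Properties as Fin
open import Data.Fin.Subset
open import Data.Fin.Subset.Properties
  using (_∈?_; _⊆?_; _⊂?_; anySubset?; p⊆q⇒∣p∣≤∣q∣;
         x∈p∪q⁻; x∈p∪q⁺; x∈p∩q⁻; x∈p∩q⁺; q⊆p∪q; x∈⁅x⁆; ∪-identityˡ)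
open import Data.List using (List; []; _∷_; map; _++_; filter; length; lookup)
open import Data.List.Relation.Unary.Any using (here; index)
open import Data.List.Relation.Unary.Any.Properties using (lookup-index)
import Data.List.Relation.Unary.All as All
open import Data.List.Relation.Unary.AllPairs using ([]; _∷_)
open import Data.List.Relation.Unary.Unique.Propositional using (Unique)
import Data.List.Relation.Unary.Unique.Propositional.Properties as Unique
import Data.List.Membership.Propositional as List
open import Data.List.Membership.Propositional.Properties
  using (∈-lookup; ∈-filter⁺; ∈-filter⁻; ∈-map⁺; ∈-map⁻; ∈-++⁺ˡ; ∈-++⁺ʳ)
open import Data.Vec using (tabulate; []; _∷_; here; there)
open import Data.Vec.Properties using (lookup∘tabulate; lookup⇒[]=; []=⇒lookup; ∷-injectiveʳ)
open import Data.Product using (Σ-syntax; ∃-syntax; _×_; _,_; proj₁; proj₂)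
open import Data.Sum using (inj₁; inj₂)
open import Function using (_∘_)
open import Relation.Nullary using (Dec; yes; does; ¬_; contradiction)
open import Relation.Nullary.Decidable
  using (_×-dec_; ¬?; map′; decidable-stable; dec-true)
open import Relation.Unary using (Pred; Decidable)
open import Relation.Binary.PropositionalEquality
  using (_≡_; refl; sym; trans; cong)

private
  variable
    n p : ℕ

⟦_⟧ : ∀ {ℓ} {P : Pred (Fin n) ℓ} → Decidable P → Subset n
⟦ P? ⟧ = tabulate (does ∘ P?)

∈⟦⟧⁺ : ∀ {ℓ} {P : Pred (Fin n) ℓ} (P? : Decidable P) {x} → P x → x ∈ ⟦ P? ⟧
∈⟦⟧⁺ P? {x} px =
  lookup⇒[]= x _ (trans (lookup∘tabulate _ x) (dec-true (P? x) px))

∈⟦⟧⁻ : ∀ {ℓ} {P : Pred (Fin n) ℓ} (P? : Decidable P) {x} → x ∈ ⟦ P? ⟧ → P x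
∈⟦⟧⁻ P? {x} x∈ = holds (P? x) (trans (sym (lookup∘tabulate _ x)) ([]=⇒lookup x∈))
  where
  holds : ∀ {a} {A : Set a} (A? : Dec A) → does A? ≡ true → A
  holds (yes a) _ = a

∈image? : (f : Fin n → Fin p) (A : Subset n) → Decidable (λ y → ∃[ x ] x ∈ A × f x ≡ y)
∈image? f A y = Fin.any? λ x → (x ∈? A) ×-dec (f x Fin.≟ y)

image : (Fin n → Fin p) → Subset n → Subset p
image f A = ⟦ ∈image? f A ⟧

image-mono : (f : Fin n → Fin p) {A B : Subset n} → A ⊆ B → image f A ⊆ image f B
image-mono f {A} {B} A⊆B y∈ with ∈⟦⟧⁻ (∈image? f A) y∈
... | x , x∈A , fx≡y = ∈⟦⟧⁺ (∈image? f B) (x , A⊆B x∈A , fx≡y)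

image-∪ : (f : Fin n → Fin p) (A B : Subset n) → image f (A ∪ B) ⊆ image f A ∪ image f B
image-∪ f A B y∈ with ∈⟦⟧⁻ (∈image? f (A ∪ B)) y∈
... | x , x∈ , fx≡y with x∈p∪q⁻ A B x∈
...   | inj₁ x∈A = x∈p∪q⁺ (inj₁ (∈⟦⟧⁺ (∈image? f A) (x , x∈A , fx≡y)))
...   | inj₂ x∈B = x∈p∪q⁺ (inj₂ (∈⟦⟧⁺ (∈image? f B) (x , x∈B , fx≡y)))

∣⁅x⁆∪A∣≤1+∣A∣ : (x : Fin n) (A : Subset n) → ∣ ⁅ x ⁆ ∪ A ∣ ≤ suc ∣ A ∣
∣⁅x⁆∪A∣≤1+∣A∣ zero    (outside ∷ A) = s≤s (≤-reflexive (cong ∣_∣ (∪-identityˡ A)))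
∣⁅x⁆∪A∣≤1+∣A∣ zero    (inside  ∷ A) =
  ≤-trans (s≤s (≤-reflexive (cong ∣_∣ (∪-identityˡ A)))) (n≤1+n _)
∣⁅x⁆∪A∣≤1+∣A∣ (suc x) (outside ∷ A) = ∣⁅x⁆∪A∣≤1+∣A∣ x A
∣⁅x⁆∪A∣≤1+∣A∣ (suc x) (inside  ∷ A) = s≤s (∣⁅x⁆∪A∣≤1+∣A∣ x A)

∣∅∣≤ : (A : Subset n) {k : ℕ} → (∀ {x} → x ∉ A) → ∣ A ∣ ≤ k
∣∅∣≤ []            x∉A = z≤n
∣∅∣≤ (outside ∷ A) x∉A = ∣∅∣≤ A (x∉A ∘ there)
∣∅∣≤ (inside  ∷ A) x∉A = contradiction here x∉A

∣image∣≤ : (f : Fin n → Fin p) (A : Subset n) → ∣ image f A ∣ ≤ ∣ A ∣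
∣image∣≤ f [] = ∣∅∣≤ (image f []) λ y∈ → no-preimage (∈⟦⟧⁻ (∈image? f []) y∈)
  where
  no-preimage : ∀ {y} → ¬ (∃[ x ] x ∈ [] × f x ≡ y)
  no-preimage (() , _)
∣image∣≤ f (outside ∷ A) = ≤-trans (p⊆q⇒∣p∣≤∣q∣ step) (∣image∣≤ (f ∘ suc) A)
  where
  step : image f (outside ∷ A) ⊆ image (f ∘ suc) A
  step y∈ with ∈⟦⟧⁻ (∈image? f (outside ∷ A)) y∈
  ... | suc x , there x∈A , fx≡y = ∈⟦⟧⁺ (∈image? (f ∘ suc) A) (x , x∈A , fx≡y)
∣image∣≤ f (inside ∷ A) =
  ≤-trans (p⊆q⇒∣p∣≤∣q∣ step)
    (≤-trans (∣⁅x⁆∪A∣≤1+∣A∣ (f zero) _) (s≤s (∣image∣≤ (f ∘ suc) A)))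
  where
  step : image f (inside ∷ A) ⊆ ⁅ f zero ⁆ ∪ image (f ∘ suc) A
  step y∈ with ∈⟦⟧⁻ (∈image? f (inside ∷ A)) y∈
  ... | zero  , _         , refl = x∈p∪q⁺ (inj₁ (x∈⁅x⁆ (f zero)))
  ... | suc x , there x∈A , fx≡y =
    x∈p∪q⁺ (inj₂ (∈⟦⟧⁺ (∈image? (f ∘ suc) A) (x , x∈A , fx≡y)))

-- Matroids are given by their rank functions; the ground set is Fin n.
record Matroid (n : ℕ) : Set where
  field
    rank            : Subset n → ℕ
    rank-bounded    : ∀ X → rank X ≤ ∣ X ∣
    rank-mono       : ∀ {X Y} → X ⊆ Y → rank X ≤ rank Y
    rank-submodular : ∀ X Y → rank (X ∪ Y) + rank (X ∩ Y) ≤ rank X + rank Y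

open Matroid public

infix 4 _≈_

_≈_ : Matroid n → Matroid n → Set
M ≈ M′ = ∀ X → rank M X ≡ rank M′ X

r : Matroid n → ℕ
r M = rank M ⊤

cl : Matroid n → Subset n → Subset n
cl M X = ⟦ (λ e → rank M (X ∪ ⁅ e ⁆) ≟ rank M X) ⟧

Independent : Matroid n → Pred (Subset n) _
Independent M X = rank M X ≡ ∣ X ∣

IsCircuit : Matroid n → Pred (Subset n) _
IsCircuit M C = ¬ Independent M C × (∀ {D} → D ⊂ C → Independent M D)

independent? : (M : Matroid n) → Decidable (Independent M)
independent? M X = rank M X ≟ ∣ X ∣

isCircuit? : (M : Matroid n) → Decidable (IsCircuit M)
isCircuit? M C = ¬? (independent? M C) ×-dec
  map′ (λ none {D} D⊂C → decidable-stable (independent? M D) λ dep → none (D , D⊂C , dep))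
       (λ { min (D , D⊂C , dep) → dep (min D⊂C) })
       (¬? (anySubset? λ D → (D ⊂? C) ×-dec ¬? (independent? M D)))

subsets : ∀ n → List (Subset n)
subsets zero    = [] ∷ []
subsets (suc n) = map (outside ∷_) (subsets n) ++ map (inside ∷_) (subsets n)

-- The set of circuits of M is represented by Fin (#circuits M), via the bijection
-- circuit M: see circuit-isCircuit, circuit-injective and circuit-surjective.
circuits : Matroid n → List (Subset n)
circuits M = filter (isCircuit? M) (subsets _)

#circuits : Matroid n → ℕ
#circuits M = length (circuits M)

circuit : (M : Matroid n) → Fin (#circuits M) → Subset n
circuit M = lookup (circuits M)

∈subsets : (X : Subset n) → X List.∈ subsets n
∈subsets []            = here refl
∈subsets (outside ∷ X) = ∈-++⁺ˡ (∈-map⁺ (outside ∷_) (∈subsets X))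
∈subsets (inside  ∷ X) = ∈-++⁺ʳ _ (∈-map⁺ (inside ∷_) (∈subsets X))

subsets-unique : ∀ n → Unique (subsets n)
subsets-unique zero    = All.[] ∷ []
subsets-unique (suc n) =
  Unique.++⁺ (Unique.map⁺ ∷-injectiveʳ (subsets-unique n))
             (Unique.map⁺ ∷-injectiveʳ (subsets-unique n)) disjoint
  where
  disjoint : ∀ {X} → ¬ (X List.∈ map (outside ∷_) (subsets n) ×
                        X List.∈ map (inside  ∷_) (subsets n))
  disjoint (X∈ , X∈′) with ∈-map⁻ (outside ∷_) X∈ | ∈-map⁻ (inside ∷_) X∈′
  ... | _ , _ , refl | _ , _ , ()

lookup-injective : ∀ {a} {A : Set a} {xs : List A} → Unique xs →
                   ∀ i j → lookup xs i ≡ lookup xs j → i ≡ j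
lookup-injective (_  ∷ _)  zero    zero    _  = refl
lookup-injective (x∉ ∷ _)  zero    (suc j) eq = contradiction eq (All.lookup x∉ (∈-lookup j))
lookup-injective (x∉ ∷ _)  (suc i) zero    eq = contradiction (sym eq) (All.lookup x∉ (∈-lookup i))
lookup-injective (_  ∷ xs) (suc i) (suc j) eq = cong suc (lookup-injective xs i j eq)

circuit-isCircuit : (M : Matroid n) (i : Fin (#circuits M)) → IsCircuit M (circuit M i)
circuit-isCircuit M i = proj₂ (∈-filter⁻ (isCircuit? M) {xs = subsets _} (∈-lookup i))

circuit-injective : (M : Matroid n) → ∀ i j → circuit M i ≡ circuit M j → i ≡ j
circuit-injective M = lookup-injective (Unique.filter⁺ (isCircuit? M) (subsets-unique _))

circuit-surjective : (M : Matroid n) → ∀ {C} → IsCircuit M C → ∃[ i ] circuit M i ≡ C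
circuit-surjective M {C} isC = index C∈ , sym (lookup-index C∈)
  where
  C∈ : C List.∈ circuits M
  C∈ = ∈-filter⁺ (isCircuit? M) (∈subsets C) isC

⋃ᶜ : (M : Matroid n) → Subset (#circuits M) → Subset n
⋃ᶜ M 𝒞 = ⟦ (λ x → Fin.any? λ i → (i ∈? 𝒞) ×-dec (x ∈? circuit M i)) ⟧

Perfect : (M : Matroid n) → Pred (Subset (#circuits M)) _
Perfect M 𝒞 =
  (∣ ⋃ᶜ M 𝒞 ∣ ∸ rank M (⋃ᶜ M 𝒞) ≡ ∣ 𝒞 ∣) ×
  (∀ i → i ∈ 𝒞 → ¬ (circuit M i ⊆ ⋃ᶜ M (𝒞 - i)))

-- The circuits of the restriction M|X: its ground set is X and its rank function agrees
-- with that of M, so these are the circuits of M contained in X.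
circuits∣ : (M : Matroid n) → Subset n → Subset (#circuits M)
circuits∣ M X = ⟦ (λ i → circuit M i ⊆? X) ⟧

-- A bijection from Fin n to S, used to regard matroids with ground set S as elements
-- of Matroid n.
record Labelling (n : ℕ) (S : Subset p) : Set where
  field
    to         : Fin n → Fin p
    to-∈       : ∀ i → to i ∈ S
    injective  : ∀ {i j} → to i ≡ to j → i ≡ j
    surjective : ∀ {x} → x ∈ S → ∃[ i ] to i ≡ x

open Labelling public

-- The deletion P \ X, with its ground set E(P) − X labelled by φ.
delete : (P : Matroid p) (X : Subset p) → Labelling n (∁ X) → Matroid n
delete P X φ = record
  { rank            = λ A → rank P (im A)
  ; rank-bounded    = λ A → ≤-trans (rank-bounded P (im A)) (∣image∣≤ (to φ) A)
  ; rank-mono       = λ A⊆B → rank-mono P (image-mono (to φ) A⊆B)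
  ; rank-submodular = λ A B → ≤-trans
      (+-mono-≤ (rank-mono P (image-∪ (to φ) A B)) (rank-mono P (im-∩ A B)))
      (rank-submodular P (im A) (im B))
  }
  where
  im = image (to φ)

  im-∩ : ∀ A B → im (A ∩ B) ⊆ im A ∩ im B
  im-∩ A B y∈ = x∈p∩q⁺ ( image-mono (to φ) (proj₁ ∘ x∈p∩q⁻ A B) y∈
                       , image-mono (to φ) (proj₂ ∘ x∈p∩q⁻ A B) y∈ )

-- The contraction P / X, with its ground set E(P) − X labelled by φ.
contract : (P : Matroid p) (X : Subset p) → Labelling n (∁ X) → Matroid n
contract P X φ = record
  { rank            = λ A → rank P (im A ∪ X) ∸ rank P X
  ; rank-bounded    = bounded
  ; rank-mono       = λ A⊆B → ∸-monoˡ-≤ (rank P X) (rank-mono P (im∪X-mono A⊆B))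
  ; rank-submodular = submodular
  }
  where
  im = image (to φ)

  im∪X-mono : ∀ {A B} → A ⊆ B → im A ∪ X ⊆ im B ∪ X
  im∪X-mono {A} A⊆B y∈ with x∈p∪q⁻ (im A) X y∈
  ... | inj₁ y∈A = x∈p∪q⁺ (inj₁ (image-mono (to φ) A⊆B y∈A))
  ... | inj₂ y∈X = x∈p∪q⁺ (inj₂ y∈X)

  bounded : ∀ A → rank P (im A ∪ X) ∸ rank P X ≤ ∣ A ∣
  bounded A = m≤n+o⇒m∸n≤o (rank P (im A ∪ X)) (rank P X) (begin
    rank P (im A ∪ X)                      ≤⟨ m≤m+n _ _ ⟩
    rank P (im A ∪ X) + rank P (im A ∩ X)  ≤⟨ rank-submodular P (im A) X ⟩
    rank P (im A) + rank P X               ≤⟨ +-monoˡ-≤ _ (rank-bounded P (im A)) ⟩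
    ∣ im A ∣ + rank P X                    ≤⟨ +-monoˡ-≤ _ (∣image∣≤ (to φ) A) ⟩
    ∣ A ∣ + rank P X                       ≡⟨ +-comm ∣ A ∣ _ ⟩
    rank P X + ∣ A ∣                       ∎)
    where open ≤-Reasoning

  ∪-case : ∀ A B → im (A ∪ B) ∪ X ⊆ (im A ∪ X) ∪ (im B ∪ X)
  ∪-case A B y∈ with x∈p∪q⁻ (im (A ∪ B)) X y∈
  ... | inj₂ y∈X = x∈p∪q⁺ (inj₁ (x∈p∪q⁺ (inj₂ y∈X)))
  ... | inj₁ y∈AB with x∈p∪q⁻ (im A) (im B) (image-∪ (to φ) A B y∈AB)
  ...   | inj₁ y∈A = x∈p∪q⁺ (inj₁ (x∈p∪q⁺ (inj₁ y∈A)))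
  ...   | inj₂ y∈B = x∈p∪q⁺ (inj₂ (x∈p∪q⁺ (inj₁ y∈B)))

  ∩-case : ∀ A B → im (A ∩ B) ∪ X ⊆ (im A ∪ X) ∩ (im B ∪ X)
  ∩-case A B y∈ = x∈p∩q⁺ ( im∪X-mono (proj₁ ∘ x∈p∩q⁻ A B) y∈
                         , im∪X-mono (proj₂ ∘ x∈p∩q⁻ A B) y∈ )

  submodular : ∀ A B →
    (rank P (im (A ∪ B) ∪ X) ∸ rank P X) + (rank P (im (A ∩ B) ∪ X) ∸ rank P X) ≤
    (rank P (im A ∪ X) ∸ rank P X) + (rank P (im B ∪ X) ∸ rank P X)
  submodular A B = cancel (≥X (A ∪ B)) (≥X (A ∩ B)) (≥X A) (≥X B)
    (≤-trans (+-mono-≤ (rank-mono P (∪-case A B)) (rank-mono P (∩-case A B)))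
             (rank-submodular P (im A ∪ X) (im B ∪ X)))
    where
    ≥X : ∀ A → rank P X ≤ rank P (im A ∪ X)
    ≥X A = rank-mono P (q⊆p∪q (im A) X)

    regroup : ∀ a b k → (a + b) + (k + k) ≡ (a + k) + (b + k)
    regroup = solve 3 (λ a b k → (a :+ b) :+ (k :+ k) := (a :+ k) :+ (b :+ k)) refl
      where open +-*-Solver

    cancel : ∀ {a b c d k} → k ≤ a → k ≤ b → k ≤ c → k ≤ d → a + b ≤ c + d →
             (a ∸ k) + (b ∸ k) ≤ (c ∸ k) + (d ∸ k)
    cancel {a} {b} {c} {d} {k} k≤a k≤b k≤c k≤d le = +-cancelʳ-≤ (k + k) _ _ (begin
      (a ∸ k) + (b ∸ k) + (k + k)    ≡⟨ restore k≤a k≤b ⟩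
      a + b                          ≤⟨ le ⟩
      c + d                          ≡⟨ restore k≤c k≤d ⟨
      (c ∸ k) + (d ∸ k) + (k + k)    ∎)
      where
      open ≤-Reasoning
      restore : ∀ {u v} → k ≤ u → k ≤ v → (u ∸ k) + (v ∸ k) + (k + k) ≡ u + v
      restore {u} {v} k≤u k≤v rewrite regroup (u ∸ k) (v ∸ k) k | m∸n+n≡m k≤u | m∸n+n≡m k≤v = refl

IsLift : Matroid n → Matroid n → Set
IsLift {n} K M =
  ∃[ p ] Σ[ P ∈ Matroid p ] Σ[ X ∈ Subset p ] Σ[ φ ∈ Labelling n (∁ X) ]
    delete P X φ ≈ K × contract P X φ ≈ M

IsRankLift : ℕ → Matroid n → Matroid n → Set
IsRankLift k K M = IsLift K M × r K ≡ r M + k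

{-# OPTIONS --safe #-}
module Submission where

-- The function ρ(A, S) = r_M(A) + r_N(𝒞(A) ∪ S), where 𝒞(A) is the set of circuits of M|A, is the
-- rank function of a matroid P on the disjoint union of E(M) and E(N); then Mᴺ = P \ E(N) and
-- M = P / E(N). By diminishing returns, everything reduces to adding one element e to a set Y. Either
-- e is a coloop of M|(Y ∪ e), and no circuits appear, or there is a circuit C of M with
-- e ∈ C ⊆ Y ∪ e. In the latter case 𝒞(Y) ∪ {C} spans 𝒞(Y ∪ e) in N: the fundamental circuits with
-- respect to a basis J of Y containing C - e form a perfect collection whose union contains every
-- circuit in Y ∪ e.

open import Defs
open import Data.Nat using (ℕ; zero; suc; _+_; _∸_; _≤_; _<_; s≤s; z≤n; _≤?_; _≟_; s≤s⁻¹)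
open import Data.Nat.Properties
open import Data.Fin using (Fin; zero; suc; _↑ˡ_; _↑ʳ_; splitAt; join)
import Data.Fin.Properties as Fin
open import Data.Fin.Subset
open import Data.Fin.Subset.Properties
open import Data.Fin.Subset.Induction using (⊂-wellFounded; Acc; acc)
open import Data.Vec using ([]; _∷_; here; there)
open import Data.Product using (Σ-syntax; ∃-syntax; _×_; _,_; proj₁; proj₂)
open import Data.Sum using (_⊎_; inj₁; inj₂; [_,_]′)
open import Function using (_∘_; id; case_of_)
open import Relation.Nullary using (Dec; yes; no; ¬_; contradiction; ¬?; _×-dec_)
open import Relation.Nullary.Decidable using (decidable-stable)
open import Relation.Binary.PropositionalEquality
  using (_≡_; _≢_; refl; sym; trans; cong; cong₂; subst)
open import Algebra.Properties.CommutativeSemigroup +-commutativeSemigroup using (x∙yz≈y∙xz; interchange)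
open import Data.Nat.Tactic.RingSolver using (solve-∀)
open ≤-Reasoning

private
  variable
    n m : ℕ
    X Y Z : Subset n
    x y e : Fin n

-- Finite subsets and their cardinalities.

x∈p─q⇒x∉q : (p q : Subset n) → x ∈ p ─ q → x ∉ q
x∈p─q⇒x∉q (_ ∷ p) (_ ∷ q)      (there x∈) (there x∈q) = x∈p─q⇒x∉q p q x∈ x∈q
x∈p─q⇒x∉q (_ ∷ p) (inside ∷ q) ()         here

x∈p-y⇒x≢y : (p : Subset n) → x ∈ p - y → x ≢ y
x∈p-y⇒x≢y {y = y} p x∈ refl = x∈p─q⇒x∉q p ⁅ y ⁆ x∈ (x∈⁅x⁆ y)

p-x⊆p : (p : Subset n) → p - x ⊆ p
p-x⊆p {x = x} p = p─q⊆p p ⁅ x ⁆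

x∉p-x : (p : Subset n) → x ∉ p - x
x∉p-x p x∈ = x∈p-y⇒x≢y p x∈ refl

∪-lub : X ⊆ Z → Y ⊆ Z → X ∪ Y ⊆ Z
∪-lub {X = X} {Y = Y} X⊆Z Y⊆Z x∈ = [ X⊆Z , Y⊆Z ]′ (x∈p∪q⁻ X Y x∈)

∪-mono : {X X′ Y Y′ : Subset n} → X ⊆ X′ → Y ⊆ Y′ → X ∪ Y ⊆ X′ ∪ Y′
∪-mono X⊆ Y⊆ = ∪-lub (p⊆p∪q _ ∘ X⊆) (q⊆p∪q _ _ ∘ Y⊆)

∪-monoˡ : X ⊆ Y → X ∪ Z ⊆ Y ∪ Z
∪-monoˡ X⊆Y = ∪-mono X⊆Y ⊆-refl

⁅⁆⊆ : x ∈ X → ⁅ x ⁆ ⊆ X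
⁅⁆⊆ {x = x} {X = X} x∈X y∈ = subst (_∈ X) (sym (x∈⁅y⁆⇒x≡y x y∈)) x∈X

x∈p∪⁅x⁆ : (p : Subset n) → x ∈ p ∪ ⁅ x ⁆
x∈p∪⁅x⁆ {x = x} p = q⊆p∪q p ⁅ x ⁆ (x∈⁅x⁆ x)

x∈p∪⁅y⁆⁻ : (p : Subset n) → x ∈ p ∪ ⁅ y ⁆ → x ∈ p ⊎ x ≡ y
x∈p∪⁅y⁆⁻ {y = y} p x∈ with x∈p∪q⁻ p ⁅ y ⁆ x∈
... | inj₁ x∈p = inj₁ x∈p
... | inj₂ x∈y = inj₂ (x∈⁅y⁆⇒x≡y y x∈y)

p⊆p-x∪⁅x⁆ : (p : Subset n) (x : Fin n) → p ⊆ (p - x) ∪ ⁅ x ⁆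
p⊆p-x∪⁅x⁆ p x {y} y∈p with y Fin.≟ x
... | yes refl = x∈p∪⁅x⁆ (p - x)
... | no  y≢x  = p⊆p∪q ⁅ x ⁆ (x∈p∧x≢y⇒x∈p-y y∈p y≢x)

p⊆q∪⁅x⁆⇒p-x⊆q : (p q : Subset n) → p ⊆ q ∪ ⁅ x ⁆ → p - x ⊆ q
p⊆q∪⁅x⁆⇒p-x⊆q p q p⊆ y∈ with x∈p∪⁅y⁆⁻ q (p⊆ (p-x⊆p p y∈))
... | inj₁ y∈q = y∈q
... | inj₂ y≡x = contradiction y≡x (x∈p-y⇒x≢y p y∈)

p⊆q∪⁅x⁆∧x∉p⇒p⊆q : (p q : Subset n) → p ⊆ q ∪ ⁅ x ⁆ → x ∉ p → p ⊆ q
p⊆q∪⁅x⁆∧x∉p⇒p⊆q p q p⊆ x∉p y∈ with x∈p∪⁅y⁆⁻ q (p⊆ y∈)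
... | inj₁ y∈q  = y∈q
... | inj₂ refl = contradiction y∈ x∉p

∣p∪⁅x⁆∣≡1+∣p∣ : (p : Subset n) → x ∉ p → ∣ p ∪ ⁅ x ⁆ ∣ ≡ suc ∣ p ∣
∣p∪⁅x⁆∣≡1+∣p∣ {x = zero}  (inside  ∷ p) x∉ = contradiction here x∉
∣p∪⁅x⁆∣≡1+∣p∣ {x = zero}  (outside ∷ p) x∉ = cong (suc ∘ ∣_∣) (∪-identityʳ p)
∣p∪⁅x⁆∣≡1+∣p∣ {x = suc x} (inside  ∷ p) x∉ = cong suc (∣p∪⁅x⁆∣≡1+∣p∣ p (x∉ ∘ there))
∣p∪⁅x⁆∣≡1+∣p∣ {x = suc x} (outside ∷ p) x∉ = ∣p∪⁅x⁆∣≡1+∣p∣ p (x∉ ∘ there)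

x∈p⇒1+∣p-x∣≡∣p∣ : (p : Subset n) → x ∈ p → suc ∣ p - x ∣ ≡ ∣ p ∣
x∈p⇒1+∣p-x∣≡∣p∣ {x = x} p x∈p = trans (sym (∣p∪⁅x⁆∣≡1+∣p∣ (p - x) (x∉p-x p)))
  (cong ∣_∣ (⊆-antisym (∪-lub (p-x⊆p p) (⁅⁆⊆ x∈p)) (p⊆p-x∪⁅x⁆ p x)))

q⊆p⇒∣p─q∣+∣q∣≡∣p∣ : (p q : Subset n) → q ⊆ p → ∣ p ─ q ∣ + ∣ q ∣ ≡ ∣ p ∣
q⊆p⇒∣p─q∣+∣q∣≡∣p∣ []            []            _  = refl
q⊆p⇒∣p─q∣+∣q∣≡∣p∣ (inside  ∷ p) (inside  ∷ q) q⊆p =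
  trans (+-suc _ _) (cong suc (q⊆p⇒∣p─q∣+∣q∣≡∣p∣ p q (drop-∷-⊆ q⊆p)))
q⊆p⇒∣p─q∣+∣q∣≡∣p∣ (inside  ∷ p) (outside ∷ q) q⊆p =
  cong suc (q⊆p⇒∣p─q∣+∣q∣≡∣p∣ p q (drop-∷-⊆ q⊆p))
q⊆p⇒∣p─q∣+∣q∣≡∣p∣ (outside ∷ p) (outside ∷ q) q⊆p = q⊆p⇒∣p─q∣+∣q∣≡∣p∣ p q (drop-∷-⊆ q⊆p)
q⊆p⇒∣p─q∣+∣q∣≡∣p∣ (outside ∷ p) (inside  ∷ q) q⊆p = contradiction (q⊆p here) λ ()

-- Induction on `A`, deleting from `B` the image of each element used. The map takes a membership
-- proof so that it can return a witness extracted from that proof, as is needed to match circuits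
-- with elements.
injection⇒∣∣≤ : (A : Subset n) (B : Subset m) (g : ∀ {x} → x ∈ A → Fin m) →
  (∀ {x} (x∈ : x ∈ A) → g x∈ ∈ B) →
  (∀ {x y} (x∈ : x ∈ A) (y∈ : y ∈ A) → g x∈ ≡ g y∈ → x ≡ y) → ∣ A ∣ ≤ ∣ B ∣
injection⇒∣∣≤ []            B g g∈ inj = z≤n
injection⇒∣∣≤ (outside ∷ A) B g g∈ inj = injection⇒∣∣≤ A B (g ∘ there) (g∈ ∘ there)
  λ x∈ y∈ → Fin.suc-injective ∘ inj (there x∈) (there y∈)
injection⇒∣∣≤ (inside  ∷ A) B g g∈ inj = ≤-trans
  (s≤s (injection⇒∣∣≤ A (B - g here) (g ∘ there)
    (λ x∈ → x∈p∧x≢y⇒x∈p-y (g∈ (there x∈)) λ eq → contradiction (inj (there x∈) here eq) λ ())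
    λ x∈ y∈ → Fin.suc-injective ∘ inj (there x∈) (there y∈)))
  (≤-reflexive (x∈p⇒1+∣p-x∣≡∣p∣ B (g∈ here)))

-- The set grows from `X` to `Z` one element at a time. The counter in `go` bounds the number of
-- elements still to be added.
⊆-induction : ∀ {ℓ} (P : Subset n → Set ℓ) → X ⊆ Z → P X →
  (∀ {Y e} → X ⊆ Y → Y ⊆ Z → e ∈ Z → e ∉ Y → P Y → P (Y ∪ ⁅ e ⁆)) → P Z
⊆-induction {X = X} {Z = Z} P X⊆Z PX step = go ∣ Z ∣ X ⊆-refl X⊆Z (m≤m+n _ _) PX
  where
  go : ∀ k Y → X ⊆ Y → Y ⊆ Z → ∣ Z ∣ ≤ k + ∣ Y ∣ → P Y → P Z
  go k Y X⊆Y Y⊆Z le PY with Fin.any? (λ e → (e ∈? Z) ×-dec ¬? (e ∈? Y))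
  ... | no none = subst P (⊆-antisym Y⊆Z λ {e} e∈Z →
          decidable-stable (e ∈? Y) λ e∉Y → none (e , e∈Z , e∉Y)) PY
  -- With the counter at zero, `Y` is at least as large as `Z`, so no element of `Z` can be missing.
  go zero Y X⊆Y Y⊆Z le PY | yes (e , e∈Z , e∉Y) =
    contradiction (p⊂q⇒∣p∣<∣q∣ (Y⊆Z , e , e∈Z , e∉Y)) (≤⇒≯ le)
  go (suc k) Y X⊆Y Y⊆Z le PY | yes (e , e∈Z , e∉Y) =
    go k (Y ∪ ⁅ e ⁆) (p⊆p∪q _ ∘ X⊆Y) (∪-lub Y⊆Z (⁅⁆⊆ e∈Z))
      (≤-trans le (≤-reflexive (trans (sym (+-suc k _)) (cong (k +_) (sym (∣p∪⁅x⁆∣≡1+∣p∣ Y e∉Y))))))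
      (step X⊆Y Y⊆Z e∈Z e∉Y PY)

-- Rank, span, nullity and bases.

module _ (M : Matroid n) where

  rank-∪ : X ⊆ Y → X ⊆ Z → rank M (Y ∪ Z) + rank M X ≤ rank M Y + rank M Z
  rank-∪ {X} {Y} {Z} X⊆Y X⊆Z = ≤-trans
    (+-monoʳ-≤ _ (rank-mono M λ x∈ → x∈p∩q⁺ (X⊆Y x∈ , X⊆Z x∈))) (rank-submodular M Y Z)

  -- Submodularity for `Y` and `X ∪ ⁅ e ⁆`, whose intersection contains `X`.
  rank-diminishing : X ⊆ Y →
    rank M (Y ∪ ⁅ e ⁆) + rank M X ≤ rank M Y + rank M (X ∪ ⁅ e ⁆)
  rank-diminishing {Y = Y} X⊆Y = ≤-trans
    (+-monoˡ-≤ _ (rank-mono M (∪-mono ⊆-refl (q⊆p∪q _ _)))) (rank-∪ X⊆Y (p⊆p∪q _))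

  rank-∪-≤ : ∀ X Y → rank M (X ∪ Y) ≤ rank M X + rank M Y
  rank-∪-≤ X Y = ≤-trans (m≤m+n _ _) (rank-submodular M X Y)

  rank-∪⁅⁆ : ∀ Y e → rank M (Y ∪ ⁅ e ⁆) ≤ suc (rank M Y)
  rank-∪⁅⁆ Y e = begin
    rank M (Y ∪ ⁅ e ⁆)         ≤⟨ rank-∪-≤ Y ⁅ e ⁆ ⟩
    rank M Y + rank M ⁅ e ⁆    ≤⟨ +-monoʳ-≤ _ (rank-bounded M ⁅ e ⁆) ⟩
    rank M Y + ∣ ⁅ e ⁆ ∣       ≡⟨ cong (rank M Y +_) (∣⁅x⁆∣≡1 e) ⟩
    rank M Y + 1               ≡⟨ +-comm _ 1 ⟩
    suc (rank M Y)             ∎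

  -- The inequality `rank M (X ∪ ⁅ e ⁆) ≤ rank M X` expresses that `e` is in the closure of `X`;
  -- diminishing returns carries it to larger sets.
  span-mono : X ⊆ Y → rank M (X ∪ ⁅ e ⁆) ≤ rank M X → rank M (Y ∪ ⁅ e ⁆) ≤ rank M Y
  span-mono {X} {Y} X⊆Y le = +-cancelʳ-≤ (rank M X) _ _
    (≤-trans (rank-diminishing X⊆Y) (+-monoʳ-≤ (rank M Y) le))

  span-∪ : ∀ Y Z → (∀ {x} → x ∈ Z → rank M (Y ∪ ⁅ x ⁆) ≤ rank M Y) →
    rank M (Y ∪ Z) ≤ rank M Y
  span-∪ Y Z spans = ⊆-induction (λ W → rank M (Y ∪ W) ≤ rank M Y) ⊥⊆
    (rank-mono M (∪-lub ⊆-refl ⊥⊆))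
    λ {W} {e} _ _ e∈Z _ ih → begin
      rank M (Y ∪ (W ∪ ⁅ e ⁆))   ≡⟨ cong (rank M) (∪-assoc Y W ⁅ e ⁆) ⟨
      rank M ((Y ∪ W) ∪ ⁅ e ⁆)   ≤⟨ span-mono (p⊆p∪q W) (spans e∈Z) ⟩
      rank M (Y ∪ W)             ≤⟨ ih ⟩
      rank M Y                   ∎

  -- Each added element raises the size by one and the rank by at most one. The nullities, size
  -- minus rank, are compared additively to avoid truncated subtraction.
  nullity-mono : X ⊆ Y → rank M Y + ∣ X ∣ ≤ rank M X + ∣ Y ∣
  nullity-mono {X} X⊆Y = ⊆-induction (λ Y → rank M Y + ∣ X ∣ ≤ rank M X + ∣ Y ∣) X⊆Y ≤-refl
    λ {Y} {e} _ _ _ e∉Y ih → begin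
      rank M (Y ∪ ⁅ e ⁆) + ∣ X ∣    ≤⟨ +-monoˡ-≤ _ (rank-∪⁅⁆ Y e) ⟩
      suc (rank M Y + ∣ X ∣)        ≤⟨ s≤s ih ⟩
      suc (rank M X + ∣ Y ∣)        ≡⟨ +-suc _ _ ⟨
      rank M X + suc ∣ Y ∣          ≡⟨ cong (rank M X +_) (∣p∪⁅x⁆∣≡1+∣p∣ Y e∉Y) ⟨
      rank M X + ∣ Y ∪ ⁅ e ⁆ ∣      ∎

  -- A coloop of the restriction to `Y` is spanned by no subset of `Y` avoiding it, so every step
  -- from `X` up to `Y` raises the rank. With `nullity-mono` this makes the two nullities equal.
  coloops⇒nullity-≤ : X ⊆ Y → (∀ {e} → e ∈ Y → e ∉ X → rank M (Y - e) < rank M Y) →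
    rank M X + ∣ Y ∣ ≤ rank M Y + ∣ X ∣
  coloops⇒nullity-≤ {X} {Z} X⊆Z coloop =
    ⊆-induction (λ Y → rank M X + ∣ Y ∣ ≤ rank M Y + ∣ X ∣) X⊆Z ≤-refl
    λ {Y} {e} X⊆Y Y⊆Z e∈Z e∉Y ih → begin
      rank M X + ∣ Y ∪ ⁅ e ⁆ ∣      ≡⟨ cong (rank M X +_) (∣p∪⁅x⁆∣≡1+∣p∣ Y e∉Y) ⟩
      rank M X + suc ∣ Y ∣          ≡⟨ +-suc _ _ ⟩
      suc (rank M X + ∣ Y ∣)        ≤⟨ s≤s ih ⟩
      suc (rank M Y) + ∣ X ∣        ≤⟨ +-monoˡ-≤ _ (≰⇒> λ le → <⇒≱ (coloop e∈Z (e∉Y ∘ X⊆Y))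
                                         (≤-trans (rank-mono M (p⊆p-x∪⁅x⁆ Z e))
                                           (span-mono (λ y∈Y → x∈p∧x≢y⇒x∈p-y (Y⊆Z y∈Y)
                                             λ { refl → e∉Y y∈Y }) le))) ⟩
      rank M (Y ∪ ⁅ e ⁆) + ∣ X ∣    ∎

  independent-⊆ : X ⊆ Y → Independent M Y → Independent M X
  independent-⊆ {X} {Y} X⊆Y indep = ≤-antisym (rank-bounded M X)
    (+-cancelˡ-≤ (rank M Y) _ _ (≤-trans (nullity-mono X⊆Y)
      (≤-reflexive (trans (cong (rank M X +_) (sym indep)) (+-comm (rank M X) _)))))

  ≤rank⇒independent : ∣ X ∣ ≤ rank M X → Independent M X
  ≤rank⇒independent {X} = ≤-antisym (rank-bounded M X)

  -- Greedy: a new element joins `J` exactly when it raises the rank of the part of `Y` seen so far.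
  extend-to-basis : X ⊆ Y → Independent M X →
    ∃[ J ] X ⊆ J × J ⊆ Y × Independent M J × rank M Y ≤ rank M J
  extend-to-basis {X} X⊆Y indep = ⊆-induction
    (λ Y → ∃[ J ] X ⊆ J × J ⊆ Y × Independent M J × rank M Y ≤ rank M J) X⊆Y
    (X , ⊆-refl , ⊆-refl , indep , ≤-refl) step
    where
    step : ∀ {W e} → X ⊆ W → W ⊆ _ → e ∈ _ → e ∉ W →
      (∃[ J ] X ⊆ J × J ⊆ W × Independent M J × rank M W ≤ rank M J) →
      ∃[ J ] X ⊆ J × J ⊆ W ∪ ⁅ e ⁆ × Independent M J × rank M (W ∪ ⁅ e ⁆) ≤ rank M J
    step {W} {e} _ _ _ e∉W (J , X⊆J , J⊆W , Jind , W≤J) with rank M (W ∪ ⁅ e ⁆) ≤? rank M W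
    ... | yes le = J , X⊆J , p⊆p∪q _ ∘ J⊆W , Jind , ≤-trans le W≤J
    ... | no  gt = J ∪ ⁅ e ⁆ , p⊆p∪q _ ∘ X⊆J , ∪-monoˡ J⊆W
                 , ≤rank⇒independent (≤-trans (≤-reflexive
                     (trans (∣p∪⁅x⁆∣≡1+∣p∣ J (e∉W ∘ J⊆W)) (cong suc (sym Jind)))) J<)
                 , ≤-trans (rank-∪⁅⁆ W e) (≤-trans (s≤s W≤J) J<)
      where
      J< : rank M J < rank M (J ∪ ⁅ e ⁆)
      J< = ≰⇒> λ le → gt (span-mono J⊆W le)

  -- Circuits and their spanning properties.

  dependent⇒⊇circuit : ∀ X → ¬ Independent M X → ∃[ i ] circuit M i ⊆ X
  dependent⇒⊇circuit X = go X (⊂-wellFounded X)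
    where
    go : ∀ X → Acc _⊂_ X → ¬ Independent M X → ∃[ i ] circuit M i ⊆ X
    go X (acc rec) dep with anySubset? (λ D → (D ⊂? X) ×-dec ¬? (independent? M D))
    ... | yes (D , D⊂X , depD) with go D (rec D⊂X) depD
    ...   | i , C⊆D = i , proj₁ D⊂X ∘ C⊆D
    go X (acc rec) dep | no none with circuit-surjective M {X}
      (dep , λ {D} D⊂X → decidable-stable (independent? M D) λ depD → none (D , D⊂X , depD))
    ...   | i , refl = i , ⊆-refl

  circuit-rank : ∀ i → rank M (circuit M i) < ∣ circuit M i ∣
  circuit-rank i = ≤∧≢⇒< (rank-bounded M _) (proj₁ (circuit-isCircuit M i))

  -- By minimality `C - x` is independent and has the rank of `C`, so it spans `x`; and `C - x` lies
  -- in `Y`.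
  circuit-spans : ∀ i → x ∈ circuit M i → circuit M i ⊆ Y ∪ ⁅ x ⁆ →
    rank M (Y ∪ ⁅ x ⁆) ≤ rank M Y
  circuit-spans {x} {Y} i x∈C C⊆ = span-mono (p⊆q∪⁅x⁆⇒p-x⊆q C Y C⊆) (s≤s⁻¹ (begin
    suc (rank M ((C - x) ∪ ⁅ x ⁆))    ≤⟨ s≤s (rank-mono M (∪-lub (p-x⊆p C) (⁅⁆⊆ x∈C))) ⟩
    suc (rank M C)                    ≤⟨ circuit-rank i ⟩
    ∣ C ∣                             ≡⟨ x∈p⇒1+∣p-x∣≡∣p∣ C x∈C ⟨
    suc ∣ C - x ∣                     ≡⟨ cong suc (proj₂ (circuit-isCircuit M i) (x∈p⇒p-x⊂p x∈C)) ⟨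
    suc (rank M (C - x))              ∎))
    where C = circuit M i

  circuit⊆⇒rank-≤ : ∀ i → x ∈ circuit M i → circuit M i ⊆ Z → rank M Z ≤ rank M (Z - x)
  circuit⊆⇒rank-≤ {x} {Z} i x∈C C⊆Z = ≤-trans (rank-mono M (p⊆p-x∪⁅x⁆ Z x))
    (circuit-spans i x∈C (p⊆p-x∪⁅x⁆ Z x ∘ C⊆Z))

  -- The hypothesis bounds the nullity of `Z` by one. If `x` lay in one circuit but not in the
  -- other, `Z - x` would contain the other and have nullity at least one; restoring `x` adds no
  -- rank, so `Z` would have nullity at least two.
  circuit-unique : ∣ Z ∣ ≤ suc (rank M Z) → ∀ i j →
    circuit M i ⊆ Z → circuit M j ⊆ Z → i ≡ j
  circuit-unique {Z} null≤1 i j Ci⊆Z Cj⊆Z =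
    circuit-injective M i j (⊆-antisym (sub i j Ci⊆Z Cj⊆Z) (sub j i Cj⊆Z Ci⊆Z))
    where
    sub : ∀ i j → circuit M i ⊆ Z → circuit M j ⊆ Z → circuit M i ⊆ circuit M j
    sub i j Ci⊆Z Cj⊆Z {x} x∈Ci = decidable-stable (x ∈? C) λ x∉C →
      contradiction (begin-strict
        suc (rank M Z)          ≤⟨ s≤s (circuit⊆⇒rank-≤ i x∈Ci Ci⊆Z) ⟩
        suc (rank M (Z - x))    ≤⟨ null>0 x∉C ⟩
        ∣ Z - x ∣               <⟨ ≤-reflexive (x∈p⇒1+∣p-x∣≡∣p∣ Z (Ci⊆Z x∈Ci)) ⟩
        ∣ Z ∣                   ∎) (≤⇒≯ null≤1)
      where
      C = circuit M j
      null>0 : x ∉ C → suc (rank M (Z - x)) ≤ ∣ Z - x ∣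
      null>0 x∉C = +-cancelˡ-≤ (rank M C) _ _ (begin
        rank M C + suc (rank M (Z - x))    ≡⟨ +-suc _ _ ⟩
        suc (rank M C) + rank M (Z - x)    ≤⟨ +-monoˡ-≤ _ (circuit-rank j) ⟩
        ∣ C ∣ + rank M (Z - x)             ≡⟨ +-comm ∣ C ∣ _ ⟩
        rank M (Z - x) + ∣ C ∣             ≤⟨ nullity-mono (λ y∈C → x∈p∧x≢y⇒x∈p-y (Cj⊆Z y∈C)
                                                (λ { refl → x∉C y∈C })) ⟩
        rank M C + ∣ Z - x ∣               ∎)

  circuit⊆⋃ᶜ : ∀ 𝒞 {i} → i ∈ 𝒞 → circuit M i ⊆ ⋃ᶜ M 𝒞
  circuit⊆⋃ᶜ 𝒞 {i} i∈𝒞 x∈C = ∈⟦⟧⁺ (λ x → Fin.any? λ i → (i ∈? 𝒞) ×-dec (x ∈? circuit M i)) (i , i∈𝒞 , x∈C)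

  ∈⋃ᶜ⁻ : ∀ 𝒞 → x ∈ ⋃ᶜ M 𝒞 → ∃[ i ] i ∈ 𝒞 × x ∈ circuit M i
  ∈⋃ᶜ⁻ 𝒞 = ∈⟦⟧⁻ (λ x → Fin.any? λ i → (i ∈? 𝒞) ×-dec (x ∈? circuit M i))

  -- Fundamental circuits with respect to a basis.

  IsFundamental : Subset n → Subset n → Fin (#circuits M) → Set
  IsFundamental J X i = ∃[ x ] (x ∈ X × x ∉ J) × circuit M i ⊆ J ∪ ⁅ x ⁆

  isFundamental? : ∀ J X i → Dec (IsFundamental J X i)
  isFundamental? J X i =
    Fin.any? λ x → ((x ∈? X) ×-dec ¬? (x ∈? J)) ×-dec (circuit M i ⊆? J ∪ ⁅ x ⁆)

  fundamentals : Subset n → Subset n → Subset (#circuits M)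
  fundamentals J X = ⟦ isFundamental? J X ⟧

  circuit⊈independent : Independent M Y → ∀ i → ¬ (circuit M i ⊆ Y)
  circuit⊈independent indep i C⊆Y = proj₁ (circuit-isCircuit M i) (independent-⊆ C⊆Y indep)

  -- Otherwise the circuit would lie in the independent set. This is why `IsFundamental` need not
  -- demand that its element `x` be in the circuit.
  apex∈circuit : Independent M Y → ∀ i → circuit M i ⊆ Y ∪ ⁅ x ⁆ → x ∈ circuit M i
  apex∈circuit {Y} {x} indep i C⊆ = decidable-stable (x ∈? circuit M i) λ x∉C →
    circuit⊈independent indep i (p⊆q∪⁅x⁆∧x∉p⇒p⊆q (circuit M i) Y C⊆ x∉C)

  -- One element added to an independent set gives nullity at most one.
  fundamental-unique : Independent M Y → x ∉ Y → ∀ i j →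
    circuit M i ⊆ Y ∪ ⁅ x ⁆ → circuit M j ⊆ Y ∪ ⁅ x ⁆ → i ≡ j
  fundamental-unique {Y} {x} indep x∉Y = circuit-unique (begin
    ∣ Y ∪ ⁅ x ⁆ ∣             ≡⟨ ∣p∪⁅x⁆∣≡1+∣p∣ Y x∉Y ⟩
    suc ∣ Y ∣                 ≡⟨ cong suc indep ⟨
    suc (rank M Y)            ≤⟨ s≤s (rank-mono M (p⊆p∪q _)) ⟩
    suc (rank M (Y ∪ ⁅ x ⁆))  ∎)

  -- The parameters say that `J` is a basis of the restriction of `M` to `X`; equality of the ranks
  -- follows by monotonicity.
  module Basis {J X : Subset n} (J⊆X : J ⊆ X) (indep : Independent M J)
               (spanning : rank M X ≤ rank M J) where

    private
      ℱ = fundamentals J X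
      U = ⋃ᶜ M ℱ

    fundamental-circuit : x ∈ X → x ∉ J → ∃[ i ] circuit M i ⊆ J ∪ ⁅ x ⁆
    fundamental-circuit {x} x∈X x∉J = dependent⇒⊇circuit (J ∪ ⁅ x ⁆) λ eq →
      contradiction (begin-strict
        ∣ J ∣               <⟨ ≤-reflexive (sym (∣p∪⁅x⁆∣≡1+∣p∣ J x∉J)) ⟩
        ∣ J ∪ ⁅ x ⁆ ∣       ≡⟨ eq ⟨
        rank M (J ∪ ⁅ x ⁆)  ≤⟨ rank-mono M (∪-lub J⊆X (⁅⁆⊆ x∈X)) ⟩
        rank M X            ≤⟨ spanning ⟩
        rank M J            ≡⟨ indep ⟩
        ∣ J ∣               ∎) (<-irrefl refl)

    ⋃fundamentals⊆ : U ⊆ X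
    ⋃fundamentals⊆ y∈U =
      let i , i∈ℱ , y∈C = ∈⋃ᶜ⁻ ℱ y∈U
          x , (x∈X , _) , C⊆ = ∈⟦⟧⁻ (isFundamental? J X) i∈ℱ
      in ∪-lub J⊆X (⁅⁆⊆ x∈X) (C⊆ y∈C)

    -- The set `J - e` still spans `X - e`: the fundamental circuit of each `x` outside `J` avoids
    -- `e`, hence lies in `(J - e) ∪ ⁅ x ⁆`.
    outside-⋃⇒coloop : e ∈ X → e ∉ U → rank M (X - e) < rank M X
    outside-⋃⇒coloop {e} e∈X e∉U = begin-strict
      rank M (X - e)               ≤⟨ rank-mono M (q⊆p∪q _ _) ⟩
      rank M ((J - e) ∪ (X - e))   ≤⟨ span-∪ (J - e) (X - e) spans ⟩
      rank M (J - e)               ≤⟨ rank-bounded M _ ⟩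
      ∣ J - e ∣                    <⟨ x∈p⇒∣p-x∣<∣p∣ e∈J ⟩
      ∣ J ∣                        ≡⟨ indep ⟨
      rank M J                     ≤⟨ rank-mono M J⊆X ⟩
      rank M X                     ∎
      where
      C⊆U : x ∈ X → x ∉ J → ∀ i → circuit M i ⊆ J ∪ ⁅ x ⁆ → circuit M i ⊆ U
      C⊆U x∈X x∉J i C⊆ = circuit⊆⋃ᶜ ℱ (∈⟦⟧⁺ (isFundamental? J X) (_ , (x∈X , x∉J) , C⊆))

      e∈J : e ∈ J
      -- If `e` were outside `J`, its own fundamental circuit would put it in `U`.
      e∈J = decidable-stable (e ∈? J) λ e∉J → let i , C⊆ = fundamental-circuit e∈X e∉J in
        e∉U (C⊆U e∈X e∉J i C⊆ (apex∈circuit indep i C⊆))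

      spans : x ∈ X - e → rank M ((J - e) ∪ ⁅ x ⁆) ≤ rank M (J - e)
      spans {x} x∈ with x ∈? J
      ... | yes x∈J = rank-mono M
        (∪-lub ⊆-refl (⁅⁆⊆ (x∈p∧x≢y⇒x∈p-y x∈J (x∈p-y⇒x≢y X x∈))))
      ... | no  x∉J =
        let i , C⊆ = fundamental-circuit (p-x⊆p X x∈) x∉J
        in circuit-spans i (apex∈circuit indep i C⊆)
             (avoids i C⊆ (e∉U ∘ C⊆U (p-x⊆p X x∈) x∉J i C⊆))
        where
        avoids : ∀ i → circuit M i ⊆ J ∪ ⁅ x ⁆ → e ∉ circuit M i → circuit M i ⊆ (J - e) ∪ ⁅ x ⁆
        avoids i C⊆ e∉C {y} y∈C =
          [ (λ y∈J → p⊆p∪q _ (x∈p∧x≢y⇒x∈p-y y∈J λ y≡e → e∉C (subst (_∈ circuit M i) y≡e y∈C)))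
          , (λ y≡x → subst (_∈ (J - e) ∪ ⁅ x ⁆) (sym y≡x) (x∈p∪⁅x⁆ (J - e)))
          ]′ (x∈p∪⁅y⁆⁻ J (C⊆ y∈C))

    -- Elements of `X` outside `U` are coloops of the restriction to `X`, and a circuit contains no
    -- coloop.
    circuit⊆⋃fundamentals : ∀ i → circuit M i ⊆ X → circuit M i ⊆ U
    circuit⊆⋃fundamentals i C⊆X {y} y∈C = decidable-stable (y ∈? U) λ y∉U →
      <⇒≱ (outside-⋃⇒coloop (C⊆X y∈C) y∉U) (circuit⊆⇒rank-≤ i y∈C C⊆X)

    -- A fundamental circuit and its unique element outside `J` determine each other, which gives
    -- injections both ways.
    ∣fundamentals∣ : ∣ ℱ ∣ ≡ ∣ X ─ J ∣
    ∣fundamentals∣ = ≤-antisym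
      (injection⇒∣∣≤ ℱ (X ─ J) (λ i∈ → proj₁ (from i∈))
        (λ i∈ → let x , (x∈X , x∉J) , _ = from i∈ in x∈p∧x∉q⇒x∈p─q x∈X x∉J)
        λ {i} {j} i∈ j∈ eq → let _ , (_ , x∉J) , Ci⊆ = from i∈ ; _ , _ , Cj⊆ = from j∈ in
          fundamental-unique indep x∉J i j Ci⊆
            (subst (λ z → circuit M j ⊆ J ∪ ⁅ z ⁆) (sym eq) Cj⊆))
      (injection⇒∣∣≤ (X ─ J) ℱ (λ x∈ → proj₁ (fund x∈))
        (λ x∈ → ∈⟦⟧⁺ (isFundamental? J X)
          (_ , (p─q⊆p X J x∈ , x∈p─q⇒x∉q X J x∈) , proj₂ (fund x∈)))
        λ {x} {y} x∈ y∈ eq → apex-unique x∈ (proj₁ (fund y∈)) (proj₂ (fund y∈))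
          (subst (λ i → circuit M i ⊆ J ∪ ⁅ x ⁆) eq (proj₂ (fund x∈))))
      where
      from : ∀ {i} → i ∈ ℱ → IsFundamental J X i
      from = ∈⟦⟧⁻ (isFundamental? J X)

      fund : x ∈ X ─ J → ∃[ i ] circuit M i ⊆ J ∪ ⁅ x ⁆
      fund x∈ = fundamental-circuit (p─q⊆p X J x∈) (x∈p─q⇒x∉q X J x∈)

      apex-unique : x ∈ X ─ J → ∀ i → circuit M i ⊆ J ∪ ⁅ y ⁆ → circuit M i ⊆ J ∪ ⁅ x ⁆ → x ≡ y
      apex-unique x∈ i C⊆y C⊆x = [ (λ x∈J → contradiction x∈J (x∈p─q⇒x∉q X J x∈)) , id ]′
        (x∈p∪⁅y⁆⁻ J (C⊆y (apex∈circuit indep i C⊆x)))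

    -- The nullity of `X` is the size of `X ─ J`, hence that of `ℱ`. Passing from `X` to `U`
    -- discards only coloops, so `U` has the same nullity.
    fundamentals-perfect : Perfect M ℱ
    fundamentals-perfect = trans (cong (_∸ rank M U) ∣U∣) (m+n∸m≡n (rank M U) ∣ ℱ ∣) , irredundant
      where
      ∣X∣ : ∣ X ∣ ≡ rank M X + ∣ ℱ ∣
      ∣X∣ = begin-equality
        ∣ X ∣                ≡⟨ q⊆p⇒∣p─q∣+∣q∣≡∣p∣ X J J⊆X ⟨
        ∣ X ─ J ∣ + ∣ J ∣    ≡⟨ +-comm ∣ X ─ J ∣ _ ⟩
        ∣ J ∣ + ∣ X ─ J ∣    ≡⟨ cong (_+ ∣ X ─ J ∣) (trans (sym indep) (≤-antisym (rank-mono M J⊆X) spanning)) ⟩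
        rank M X + ∣ X ─ J ∣ ≡⟨ cong (rank M X +_) ∣fundamentals∣ ⟨
        rank M X + ∣ ℱ ∣     ∎

      ∣U∣ : ∣ U ∣ ≡ rank M U + ∣ ℱ ∣
      ∣U∣ = +-cancelˡ-≡ (rank M X) _ _ (begin-equality
        rank M X + ∣ U ∣              ≡⟨ ≤-antisym (nullity-mono ⋃fundamentals⊆)
                                           (coloops⇒nullity-≤ ⋃fundamentals⊆ outside-⋃⇒coloop) ⟩
        rank M U + ∣ X ∣              ≡⟨ cong (rank M U +_) ∣X∣ ⟩
        rank M U + (rank M X + ∣ ℱ ∣) ≡⟨ x∙yz≈y∙xz (rank M U) (rank M X) ∣ ℱ ∣ ⟩
        rank M X + (rank M U + ∣ ℱ ∣) ∎)

      irredundant : ∀ i → i ∈ ℱ → ¬ (circuit M i ⊆ ⋃ᶜ M (ℱ - i))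
      -- The element `x` outside `J` belonging to circuit `i` lies in no other fundamental circuit,
      -- since such a circuit would lie in `J ∪ ⁅ x ⁆` too.
      irredundant i i∈ℱ C⊆ =
        let x , (_ , x∉J) , Ci⊆ = ∈⟦⟧⁻ (isFundamental? J X) i∈ℱ
            j , j∈ , x∈Cj = ∈⋃ᶜ⁻ (ℱ - i) (C⊆ (apex∈circuit indep i Ci⊆))
            y , _ , Cj⊆ = ∈⟦⟧⁻ (isFundamental? J X) (p-x⊆p ℱ j∈)
        in [ x∉J , (λ x≡y → x∈p-y⇒x≢y ℱ j∈ (fundamental-unique indep x∉J j i
               (subst (λ z → circuit M j ⊆ J ∪ ⁅ z ⁆) (sym x≡y) Cj⊆) Ci⊆)) ]′
             (x∈p∪⁅y⁆⁻ J (Cj⊆ x∈Cj))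

-- Circuits of restrictions and criteria for rank functions.

∈circuits∣⁺ : (M : Matroid n) (X : Subset n) {i : Fin (#circuits M)} →
  circuit M i ⊆ X → i ∈ circuits∣ M X
∈circuits∣⁺ M X = ∈⟦⟧⁺ (λ i → circuit M i ⊆? X)

∈circuits∣⁻ : (M : Matroid n) (X : Subset n) {i : Fin (#circuits M)} →
  i ∈ circuits∣ M X → circuit M i ⊆ X
∈circuits∣⁻ M X = ∈⟦⟧⁻ (λ i → circuit M i ⊆? X)

circuits∣-mono : (M : Matroid n) → X ⊆ Y → circuits∣ M X ⊆ circuits∣ M Y
circuits∣-mono {X = X} {Y} M X⊆Y i∈ = ∈circuits∣⁺ M Y (X⊆Y ∘ ∈circuits∣⁻ M X i∈)

rank-⊥ : (M : Matroid n) → rank M ⊥ ≡ 0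
rank-⊥ {n} M = n≤0⇒n≡0 (≤-trans (rank-bounded M ⊥) (≤-reflexive (∣⊥∣≡0 n)))

-- The set `Y` grows from `A ∩ B` to `B`. An element of `B` outside `Y` is also outside `A`, so
-- diminishing returns applies to `Y ⊆ A ∪ Y`.
diminishing⇒submodular : (f : Subset n → ℕ) → (∀ {X Y} → X ⊆ Y → f X ≤ f Y) →
  (∀ {X Y e} → X ⊆ Y → e ∉ Y → f (Y ∪ ⁅ e ⁆) + f X ≤ f Y + f (X ∪ ⁅ e ⁆)) →
  ∀ A B → f (A ∪ B) + f (A ∩ B) ≤ f A + f B
diminishing⇒submodular f mono dim A B = ⊆-induction
  (λ Y → f (A ∪ Y) + f (A ∩ B) ≤ f A + f Y) (p∩q⊆q A B)
  (+-monoˡ-≤ _ (mono (∪-lub ⊆-refl (p∩q⊆p A B))))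
  λ {Y} {e} A∩B⊆Y _ e∈B e∉Y ih → begin
    f (A ∪ (Y ∪ ⁅ e ⁆)) + f (A ∩ B)    ≡⟨ cong (λ Z → f Z + f (A ∩ B)) (∪-assoc A Y ⁅ e ⁆) ⟨
    f ((A ∪ Y) ∪ ⁅ e ⁆) + f (A ∩ B)    ≤⟨ chain (f (A ∪ Y)) (f Y) ih (dim (q⊆p∪q A Y)
                                            λ e∈ → [ (λ e∈A → e∉Y (A∩B⊆Y (x∈p∩q⁺ (e∈A , e∈B)))) , e∉Y ]′
                                              (x∈p∪q⁻ A Y e∈)) ⟩
    f A + f (Y ∪ ⁅ e ⁆)                ∎
  where
  regroup : ∀ p y q i → (p + y) + (q + i) ≡ (p + i) + (q + y)
  regroup = solve-∀

  regroup′ : ∀ p y a z → (a + y) + (p + z) ≡ (p + y) + (a + z)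
  regroup′ = solve-∀

  chain : ∀ p y {a z q i} → p + i ≤ a + y → q + y ≤ p + z → q + i ≤ a + z
  chain p y {a} {z} {q} {i} le₁ le₂ = +-cancelˡ-≤ (p + y) _ _ (begin
    (p + y) + (q + i)    ≡⟨ regroup p y q i ⟩
    (p + i) + (q + y)    ≤⟨ +-mono-≤ le₁ le₂ ⟩
    (a + y) + (p + z)    ≡⟨ regroup′ p y a z ⟩
    (p + y) + (a + z)    ∎)

unit-increase⇒bounded : (f : Subset n → ℕ) → f ⊥ ≡ 0 →
  (∀ {Y e} → e ∉ Y → f (Y ∪ ⁅ e ⁆) ≤ suc (f Y)) → ∀ X → f X ≤ ∣ X ∣
unit-increase⇒bounded f f⊥≡0 unit X = ⊆-induction (λ Y → f Y ≤ ∣ Y ∣) ⊥⊆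
  (≤-trans (≤-reflexive f⊥≡0) z≤n)
  λ {Y} _ _ _ e∉Y ih → ≤-trans (unit e∉Y)
    (≤-trans (s≤s ih) (≤-reflexive (sym (∣p∪⁅x⁆∣≡1+∣p∣ Y e∉Y))))

-- Preimages and the two halves of a disjoint union.

preimage : (Fin n → Fin m) → Subset m → Subset n
preimage g A = ⟦ (λ x → g x ∈? A) ⟧

module _ (g : Fin n → Fin m) where

  ∈preimage⁺ : ∀ A → g x ∈ A → x ∈ preimage g A
  ∈preimage⁺ A = ∈⟦⟧⁺ (λ x → g x ∈? A)

  ∈preimage⁻ : ∀ A → x ∈ preimage g A → g x ∈ A
  ∈preimage⁻ A = ∈⟦⟧⁻ (λ x → g x ∈? A)

  preimage-mono : {A B : Subset m} → A ⊆ B → preimage g A ⊆ preimage g B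
  preimage-mono {A} {B} A⊆B x∈ = ∈preimage⁺ B (A⊆B (∈preimage⁻ A x∈))

  preimage-⊥ : preimage g ⊥ ≡ ⊥
  preimage-⊥ = ⊆-antisym (λ x∈ → contradiction (∈preimage⁻ ⊥ x∈) ∉⊥) ⊥⊆

  preimage-∪ : ∀ A B → preimage g (A ∪ B) ≡ preimage g A ∪ preimage g B
  preimage-∪ A B = ⊆-antisym
    (λ x∈ → x∈p∪q⁺ ([ inj₁ ∘ ∈preimage⁺ A , inj₂ ∘ ∈preimage⁺ B ]′
      (x∈p∪q⁻ A B (∈preimage⁻ (A ∪ B) x∈))))
    (∪-lub (preimage-mono (p⊆p∪q B)) (preimage-mono (q⊆p∪q A B)))

  preimage-⁅⁆ : (∀ x y → g x ≡ g y → x ≡ y) → ∀ x → preimage g ⁅ g x ⁆ ≡ ⁅ x ⁆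
  preimage-⁅⁆ inj x = ⊆-antisym
    (λ {y} y∈ → subst (_∈ ⁅ x ⁆) (sym (inj y x (x∈⁅y⁆⇒x≡y (g x) (∈preimage⁻ ⁅ g x ⁆ y∈)))) (x∈⁅x⁆ x))
    (⁅⁆⊆ (∈preimage⁺ ⁅ g x ⁆ (x∈⁅x⁆ (g x))))

  preimage-⁅⁆-outside : ∀ {z} → (∀ x → g x ≢ z) → preimage g ⁅ z ⁆ ≡ ⊥
  preimage-⁅⁆-outside {z} z∉ = ⊆-antisym
    (λ {x} x∈ → contradiction (x∈⁅y⁆⇒x≡y z (∈preimage⁻ ⁅ z ⁆ x∈)) (z∉ x)) ⊥⊆

  preimage-image : (∀ x y → g x ≡ g y → x ≡ y) → ∀ A → preimage g (image g A) ≡ A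
  preimage-image inj A = ⊆-antisym
    (λ {y} y∈ → let x , x∈A , eq = ∈⟦⟧⁻ (∈image? g A) (∈preimage⁻ (image g A) y∈) in
      subst (_∈ A) (inj x y eq) x∈A)
    (λ x∈A → ∈preimage⁺ (image g A) (∈⟦⟧⁺ (∈image? g A) (_ , x∈A , refl)))

preimage-image-disjoint : ∀ {k} (g : Fin n → Fin m) (h : Fin k → Fin m) →
  (∀ x y → g x ≢ h y) → ∀ A → preimage g (image h A) ≡ ⊥
preimage-image-disjoint g h disjoint A = ⊆-antisym
  (λ {y} y∈ → let x , _ , eq = ∈⟦⟧⁻ (∈image? h A) (∈preimage⁻ g (image h A) y∈) in
    contradiction (sym eq) (disjoint y x))
  ⊥⊆

↑ˡ≢↑ʳ : (x : Fin n) (y : Fin m) → x ↑ˡ m ≢ n ↑ʳ y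
↑ˡ≢↑ʳ {n} {m} x y eq
  with () ← trans (sym (Fin.splitAt-↑ˡ n x m)) (trans (cong (splitAt n) eq) (Fin.splitAt-↑ʳ n m y))

data SplitView (n m : ℕ) : Fin (n + m) → Set where
  left  : (x : Fin n) → SplitView n m (x ↑ˡ m)
  right : (y : Fin m) → SplitView n m (n ↑ʳ y)

splitView : ∀ n m (z : Fin (n + m)) → SplitView n m z
splitView n m z = subst (SplitView n m) (Fin.join-splitAt n m z) (view (splitAt n z))
  where
  view : (s : Fin n ⊎ Fin m) → SplitView n m (join n m s)
  view (inj₁ x) = left x
  view (inj₂ y) = right y

-- Spanning sets of circuits in `N`.

module Construction (M : Matroid n) (N : Matroid (#circuits M))
  (perfect⇒spans : ∀ 𝒞 → Perfect M 𝒞 → ∀ i → circuit M i ⊆ ⋃ᶜ M 𝒞 → i ∈ cl N 𝒞) where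

  private
    m′ = #circuits M
    𝒞 = circuits∣ M
    variable
      S T 𝒢 : Subset m′
      i : Fin m′

  -- The hypothesis on `N` is applied to the perfect collection of fundamental circuits: its closure
  -- contains every circuit inside `X`, and closure is monotone.
  fundamentals-span : ∀ {J} → J ⊆ X → Independent M J → rank M X ≤ rank M J →
    fundamentals M J X ⊆ 𝒢 → rank N (𝒢 ∪ 𝒞 X) ≤ rank N 𝒢
  fundamentals-span {X} {𝒢} {J} J⊆X indep spanning ℱ⊆𝒢 = span-∪ N 𝒢 (𝒞 X) λ {i} i∈ →
    span-mono N ℱ⊆𝒢 (≤-reflexive
      (∈⟦⟧⁻ (λ i → rank N (fundamentals M J X ∪ ⁅ i ⁆) ≟ rank N (fundamentals M J X))
        (perfect⇒spans _ B.fundamentals-perfect i (B.circuit⊆⋃fundamentals i (∈circuits∣⁻ M X i∈)))))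
    where module B = Basis M J⊆X indep spanning

  -- C - e extends to a basis J of Y, and then C is the fundamental circuit of e with respect to J.
  circuit-through-spans : e ∉ Y → e ∈ circuit M i → circuit M i ⊆ Y ∪ ⁅ e ⁆ →
    𝒞 Y ⊆ 𝒢 → i ∈ 𝒢 → rank N (𝒢 ∪ 𝒞 (Y ∪ ⁅ e ⁆)) ≤ rank N 𝒢
  circuit-through-spans {e} {Y} {i} {𝒢} e∉Y e∈C C⊆ 𝒞Y⊆𝒢 i∈𝒢 =
    let J , C-e⊆J , J⊆Y , indep , spanning = extend-to-basis M
          (p⊆q∪⁅x⁆⇒p-x⊆q (circuit M i) Y C⊆) (proj₂ (circuit-isCircuit M i) (x∈p⇒p-x⊂p e∈C))
    in fundamentals-span (p⊆p∪q _ ∘ J⊆Y) indep (≤-trans (circuit-spans M i e∈C C⊆) spanning)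
         (ℱ⊆𝒢 J C-e⊆J J⊆Y indep)
    where
    ℱ⊆𝒢 : ∀ J → circuit M i - e ⊆ J → J ⊆ Y → Independent M J →
      fundamentals M J (Y ∪ ⁅ e ⁆) ⊆ 𝒢
    ℱ⊆𝒢 J C-e⊆J J⊆Y indep {j} j∈ =
      let x , (x∈ , _) , Cj⊆ = ∈⟦⟧⁻ (isFundamental? M J (Y ∪ ⁅ e ⁆)) j∈ in
      [ (λ x∈Y → 𝒞Y⊆𝒢 (∈circuits∣⁺ M Y (∪-lub J⊆Y (⁅⁆⊆ x∈Y) ∘ Cj⊆)))
      , (λ x≡e → subst (_∈ 𝒢) (fundamental-unique M indep (e∉Y ∘ J⊆Y) i j
          (∪-monoˡ C-e⊆J ∘ p⊆p-x∪⁅x⁆ (circuit M i) e)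
          (subst (λ z → circuit M j ⊆ J ∪ ⁅ z ⁆) x≡e Cj⊆)) i∈𝒢)
      ]′ (x∈p∪⁅y⁆⁻ Y x∈)

  data Step (Y : Subset n) (e : Fin n) : Set where
    coloop  : rank M (Y ∪ ⁅ e ⁆) ≡ suc (rank M Y) → 𝒞 (Y ∪ ⁅ e ⁆) ⊆ 𝒞 Y → Step Y e
    through : rank M (Y ∪ ⁅ e ⁆) ≤ rank M Y →
              ∀ i → e ∈ circuit M i → circuit M i ⊆ Y ∪ ⁅ e ⁆ → Step Y e

  -- A circuit in `Y ∪ ⁅ e ⁆` through `e` forces `Y` to span `e`. Conversely, if `Y` spans `e`, a
  -- basis of `Y` is also one of `Y ∪ ⁅ e ⁆`, and `e` has a fundamental circuit.
  step : ∀ Y → e ∉ Y → Step Y e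
  step {e} Y e∉Y = case rank M (Y ∪ ⁅ e ⁆) ≤? rank M Y of λ where
    (no gt) → coloop (≤-antisym (rank-∪⁅⁆ M Y e) (≰⇒> gt)) λ {i} i∈ →
      let C⊆ = ∈circuits∣⁻ M (Y ∪ ⁅ e ⁆) i∈ in
      ∈circuits∣⁺ M Y (p⊆q∪⁅x⁆∧x∉p⇒p⊆q (circuit M i) Y C⊆ λ e∈C → gt (circuit-spans M i e∈C C⊆))
    (yes le) →
      let J , _ , J⊆Y , indep , spanning =
            extend-to-basis M (⊥⊆ {p = Y}) (trans (rank-⊥ M) (sym (∣⊥∣≡0 n)))
          i , C⊆ = Basis.fundamental-circuit M (p⊆p∪q _ ∘ J⊆Y) indep (≤-trans le spanning)
            (x∈p∪⁅x⁆ Y) (e∉Y ∘ J⊆Y)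
      in through le i (apex∈circuit M indep i C⊆) (∪-monoˡ J⊆Y ∘ C⊆)

  -- Unit increase and diminishing returns for `ρ`.

  ρ : Subset n → Subset m′ → ℕ
  ρ A S = rank M A + rank N (𝒞 A ∪ S)

  ρ-mono : X ⊆ Y → S ⊆ T → ρ X S ≤ ρ Y T
  ρ-mono X⊆Y S⊆T = +-mono-≤ (rank-mono M X⊆Y) (rank-mono N (∪-mono (circuits∣-mono M X⊆Y) S⊆T))

  ρ-+-mono : ∀ {A B C D S T U V} → rank M A + rank M B ≤ rank M C + rank M D →
    rank N (𝒞 A ∪ S) + rank N (𝒞 B ∪ T) ≤ rank N (𝒞 C ∪ U) + rank N (𝒞 D ∪ V) →
    ρ A S + ρ B T ≤ ρ C U + ρ D V
  ρ-+-mono {A} {B} {C} {D} {S} {T} {U} {V} M≤ N≤ = begin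
    ρ A S + ρ B T
      ≡⟨ interchange (rank M A) _ (rank M B) _ ⟩
    (rank M A + rank M B) + (rank N (𝒞 A ∪ S) + rank N (𝒞 B ∪ T))
      ≤⟨ +-mono-≤ M≤ N≤ ⟩
    (rank M C + rank M D) + (rank N (𝒞 C ∪ U) + rank N (𝒞 D ∪ V))
      ≡⟨ interchange (rank M C) _ (rank N (𝒞 C ∪ U)) _ ⟩
    ρ C U + ρ D V ∎

  -- Only one summand can grow. For a coloop it is the rank in `M`, by one; otherwise it is the rank
  -- in `N`, where the single circuit `i` together with the old set spans all new circuits.
  ρ-unitˡ : e ∉ Y → ρ (Y ∪ ⁅ e ⁆) T ≤ suc (ρ Y T)
  ρ-unitˡ {e} {Y} {T} e∉Y = by (step Y e∉Y)
    where
    by : Step Y e → ρ (Y ∪ ⁅ e ⁆) T ≤ suc (ρ Y T)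
    by (coloop rank≡ 𝒞⊆) = +-mono-≤ (≤-reflexive rank≡) (rank-mono N (∪-monoˡ 𝒞⊆))
    by (through rank≤ i e∈C C⊆) = ≤-trans (+-mono-≤ rank≤ (begin
      rank N (𝒞 (Y ∪ ⁅ e ⁆) ∪ T)    ≤⟨ rank-mono N (∪-lub (q⊆p∪q G _) (p⊆p∪q _ ∘ p⊆p∪q _ ∘ q⊆p∪q _ _)) ⟩
      rank N (G ∪ 𝒞 (Y ∪ ⁅ e ⁆))    ≤⟨ circuit-through-spans e∉Y e∈C C⊆ (p⊆p∪q _ ∘ p⊆p∪q _) (x∈p∪⁅x⁆ _) ⟩
      rank N G                      ≤⟨ rank-∪⁅⁆ N (𝒞 Y ∪ T) i ⟩
      suc (rank N (𝒞 Y ∪ T))        ∎)) (≤-reflexive (+-suc _ _))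
      where G = (𝒞 Y ∪ T) ∪ ⁅ i ⁆

  ρ-unitʳ : ∀ Y T s → ρ Y (T ∪ ⁅ s ⁆) ≤ suc (ρ Y T)
  ρ-unitʳ Y T s = begin
    rank M Y + rank N (𝒞 Y ∪ (T ∪ ⁅ s ⁆))    ≡⟨ cong (λ G → rank M Y + rank N G) (∪-assoc (𝒞 Y) T ⁅ s ⁆) ⟨
    rank M Y + rank N ((𝒞 Y ∪ T) ∪ ⁅ s ⁆)    ≤⟨ +-monoʳ-≤ (rank M Y) (rank-∪⁅⁆ N _ s) ⟩
    rank M Y + suc (rank N (𝒞 Y ∪ T))        ≡⟨ +-suc _ _ ⟩
    suc (ρ Y T)                              ∎

  ρ-diminishingʳ : ∀ s → X ⊆ Y → S ⊆ T → ρ Y (T ∪ ⁅ s ⁆) + ρ X S ≤ ρ Y T + ρ X (S ∪ ⁅ s ⁆)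
  ρ-diminishingʳ {X} {Y} {S} {T} s X⊆Y S⊆T = ρ-+-mono
    ≤-refl (begin
      rank N (𝒞 Y ∪ (T ∪ ⁅ s ⁆)) + rank N (𝒞 X ∪ S)
        ≡⟨ cong (λ G → rank N G + rank N (𝒞 X ∪ S)) (∪-assoc (𝒞 Y) T ⁅ s ⁆) ⟨
      rank N ((𝒞 Y ∪ T) ∪ ⁅ s ⁆) + rank N (𝒞 X ∪ S)
        ≤⟨ rank-diminishing N (∪-mono (circuits∣-mono M X⊆Y) S⊆T) ⟩
      rank N (𝒞 Y ∪ T) + rank N ((𝒞 X ∪ S) ∪ ⁅ s ⁆)
        ≡⟨ cong (λ G → rank N (𝒞 Y ∪ T) + rank N G) (∪-assoc (𝒞 X) S ⁅ s ⁆) ⟩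
      rank N (𝒞 Y ∪ T) + rank N (𝒞 X ∪ (S ∪ ⁅ s ⁆)) ∎)

  -- The cases concern the smaller set `X`. For a coloop the increase at `X` is at least one, while
  -- that at `Y` is at most one. Otherwise one circuit through `e` inside `X ∪ ⁅ e ⁆` serves for `Y`
  -- as well.
  ρ-diminishingˡ : X ⊆ Y → S ⊆ T → e ∉ Y → ρ (Y ∪ ⁅ e ⁆) T + ρ X S ≤ ρ Y T + ρ (X ∪ ⁅ e ⁆) S
  ρ-diminishingˡ {X} {Y} {S} {T} {e} X⊆Y S⊆T e∉Y = by (step X (e∉Y ∘ X⊆Y))
    where
    -- `H` contains both `𝒞 Y` and the new circuit, so it spans `𝒞 (Y ∪ ⁅ e ⁆)`; being a union of
    -- the two sets on the right-hand side, it is also suited to submodularity of `N`.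
    H = (𝒞 Y ∪ T) ∪ (𝒞 (X ∪ ⁅ e ⁆) ∪ S)

    by : Step X e → ρ (Y ∪ ⁅ e ⁆) T + ρ X S ≤ ρ Y T + ρ (X ∪ ⁅ e ⁆) S
    by (coloop rank≡ _) = begin
      ρ (Y ∪ ⁅ e ⁆) T + ρ X S    ≤⟨ +-monoˡ-≤ _ (ρ-unitˡ e∉Y) ⟩
      suc (ρ Y T + ρ X S)        ≡⟨ +-suc _ _ ⟨
      ρ Y T + suc (ρ X S)        ≤⟨ +-monoʳ-≤ (ρ Y T) (+-mono-≤ (≤-reflexive (sym rank≡))
                                      (rank-mono N (∪-monoˡ (circuits∣-mono M (p⊆p∪q _))))) ⟩
      ρ Y T + ρ (X ∪ ⁅ e ⁆) S    ∎
    by (through _ i e∈C C⊆) = ρ-+-mono (rank-diminishing M X⊆Y) (begin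
      rank N (𝒞 (Y ∪ ⁅ e ⁆) ∪ T) + rank N (𝒞 X ∪ S)
        ≤⟨ +-monoˡ-≤ _ (rank-mono N (∪-lub (q⊆p∪q H _) (p⊆p∪q _ ∘ p⊆p∪q _ ∘ q⊆p∪q _ _))) ⟩
      rank N (H ∪ 𝒞 (Y ∪ ⁅ e ⁆)) + rank N (𝒞 X ∪ S)
        ≤⟨ +-monoˡ-≤ _ (circuit-through-spans e∉Y e∈C (∪-monoˡ X⊆Y ∘ C⊆) (p⊆p∪q _ ∘ p⊆p∪q _)
             (q⊆p∪q _ _ (p⊆p∪q _ (∈circuits∣⁺ M (X ∪ ⁅ e ⁆) C⊆)))) ⟩
      rank N H + rank N (𝒞 X ∪ S)
        ≤⟨ rank-∪ N (∪-mono (circuits∣-mono M X⊆Y) S⊆T) (∪-monoˡ (circuits∣-mono M (p⊆p∪q _))) ⟩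
      rank N (𝒞 Y ∪ T) + rank N (𝒞 (X ∪ ⁅ e ⁆) ∪ S) ∎)

  ρ-⊥ : ρ ⊥ ⊥ ≡ 0
  ρ-⊥ = cong₂ _+_ (rank-⊥ M) (trans (cong (rank N) 𝒞⊥∪⊥≡⊥) (rank-⊥ N))
    where
    ∉𝒞⊥ : i ∉ 𝒞 ⊥
    ∉𝒞⊥ {i} i∈ = circuit⊈independent M (trans (rank-⊥ M) (sym (∣⊥∣≡0 n))) i (∈circuits∣⁻ M ⊥ i∈)

    𝒞⊥∪⊥≡⊥ : 𝒞 ⊥ ∪ ⊥ ≡ ⊥
    𝒞⊥∪⊥≡⊥ = ⊆-antisym (∪-lub (λ i∈ → contradiction i∈ ∉𝒞⊥) ⊥⊆) ⊥⊆

  ρ-⊤ : ∀ A → ρ A ⊤ ≡ rank M A + r N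
  ρ-⊤ A = cong (λ G → rank M A + rank N G) (∪-zeroʳ (𝒞 A))

  -- The matroid `P` on the disjoint union.

  private
    ιˡ : Fin n → Fin (n + m′)
    ιˡ = _↑ˡ m′

    ιʳ : Fin m′ → Fin (n + m′)
    ιʳ = n ↑ʳ_

    ιˡ-injective : ∀ x y → ιˡ x ≡ ιˡ y → x ≡ y
    ιˡ-injective = Fin.↑ˡ-injective m′

    ιʳ-injective : ∀ x y → ιʳ x ≡ ιʳ y → x ≡ y
    ιʳ-injective = Fin.↑ʳ-injective n

    partˡ : Subset (n + m′) → Subset n
    partˡ = preimage ιˡ

    partʳ : Subset (n + m′) → Subset m′
    partʳ = preimage ιʳ

  partˡ-∪-ˡ : ∀ A x → partˡ (A ∪ ⁅ ιˡ x ⁆) ≡ partˡ A ∪ ⁅ x ⁆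
  partˡ-∪-ˡ A x = trans (preimage-∪ ιˡ A _) (cong (partˡ A ∪_) (preimage-⁅⁆ ιˡ ιˡ-injective x))

  partʳ-∪-ˡ : ∀ A x → partʳ (A ∪ ⁅ ιˡ x ⁆) ≡ partʳ A
  partʳ-∪-ˡ A x = trans (preimage-∪ ιʳ A _) (trans
    (cong (partʳ A ∪_) (preimage-⁅⁆-outside ιʳ λ y eq → ↑ˡ≢↑ʳ x y (sym eq))) (∪-identityʳ (partʳ A)))

  partˡ-∪-ʳ : ∀ A y → partˡ (A ∪ ⁅ ιʳ y ⁆) ≡ partˡ A
  partˡ-∪-ʳ A y = trans (preimage-∪ ιˡ A _) (trans
    (cong (partˡ A ∪_) (preimage-⁅⁆-outside ιˡ λ x → ↑ˡ≢↑ʳ x y)) (∪-identityʳ (partˡ A)))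

  partʳ-∪-ʳ : ∀ A y → partʳ (A ∪ ⁅ ιʳ y ⁆) ≡ partʳ A ∪ ⁅ y ⁆
  partʳ-∪-ʳ A y = trans (preimage-∪ ιʳ A _) (cong (partʳ A ∪_) (preimage-⁅⁆ ιʳ ιʳ-injective y))

  rankᴾ : Subset (n + m′) → ℕ
  rankᴾ A = ρ (partˡ A) (partʳ A)

  rankᴾ-∪-ˡ : ∀ A x → rankᴾ (A ∪ ⁅ ιˡ x ⁆) ≡ ρ (partˡ A ∪ ⁅ x ⁆) (partʳ A)
  rankᴾ-∪-ˡ A x = cong₂ ρ (partˡ-∪-ˡ A x) (partʳ-∪-ˡ A x)

  rankᴾ-∪-ʳ : ∀ A y → rankᴾ (A ∪ ⁅ ιʳ y ⁆) ≡ ρ (partˡ A) (partʳ A ∪ ⁅ y ⁆)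
  rankᴾ-∪-ʳ A y = cong₂ ρ (partˡ-∪-ʳ A y) (partʳ-∪-ʳ A y)

  rankᴾ-mono : {A B : Subset (n + m′)} → A ⊆ B → rankᴾ A ≤ rankᴾ B
  rankᴾ-mono A⊆B = ρ-mono (preimage-mono ιˡ A⊆B) (preimage-mono ιʳ A⊆B)

  rankᴾ-unit : {A : Subset (n + m′)} {z : Fin (n + m′)} → z ∉ A → rankᴾ (A ∪ ⁅ z ⁆) ≤ suc (rankᴾ A)
  rankᴾ-unit {A} {z} z∉A = by (splitView n m′ z) z∉A
    where
    by : ∀ {z} → SplitView n m′ z → z ∉ A → rankᴾ (A ∪ ⁅ z ⁆) ≤ suc (rankᴾ A)
    by (left  x) z∉A = ≤-trans (≤-reflexive (rankᴾ-∪-ˡ A x)) (ρ-unitˡ (z∉A ∘ ∈preimage⁻ ιˡ A))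
    by (right y) z∉A = ≤-trans (≤-reflexive (rankᴾ-∪-ʳ A y)) (ρ-unitʳ _ _ y)

  rankᴾ-diminishing : {A B : Subset (n + m′)} {z : Fin (n + m′)} → A ⊆ B → z ∉ B →
    rankᴾ (B ∪ ⁅ z ⁆) + rankᴾ A ≤ rankᴾ B + rankᴾ (A ∪ ⁅ z ⁆)
  rankᴾ-diminishing {A} {B} A⊆B = by (splitView n m′ _)
    where
    transport : ∀ {b b′ a a′} → b ≡ b′ → a ≡ a′ → b′ + rankᴾ A ≤ rankᴾ B + a′ → b + rankᴾ A ≤ rankᴾ B + a
    transport refl refl le = le

    by : ∀ {z} → SplitView n m′ z → z ∉ B → rankᴾ (B ∪ ⁅ z ⁆) + rankᴾ A ≤ rankᴾ B + rankᴾ (A ∪ ⁅ z ⁆)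
    by (left  x) z∉B = transport (rankᴾ-∪-ˡ B x) (rankᴾ-∪-ˡ A x)
      (ρ-diminishingˡ (preimage-mono ιˡ A⊆B) (preimage-mono ιʳ A⊆B) (z∉B ∘ ∈preimage⁻ ιˡ B))
    by (right y) z∉B = transport (rankᴾ-∪-ʳ B y) (rankᴾ-∪-ʳ A y)
      (ρ-diminishingʳ y (preimage-mono ιˡ A⊆B) (preimage-mono ιʳ A⊆B))

  P : Matroid (n + m′)
  P = record
    { rank            = rankᴾ
    ; rank-bounded    = unit-increase⇒bounded rankᴾ
        (trans (cong₂ ρ (preimage-⊥ ιˡ) (preimage-⊥ ιʳ)) ρ-⊥) rankᴾ-unit
    ; rank-mono       = rankᴾ-mono
    ; rank-submodular = diminishing⇒submodular rankᴾ rankᴾ-mono rankᴾ-diminishing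
    }

  circuitElements : Subset (n + m′)
  circuitElements = image ιʳ ⊤

  φ : Labelling n (∁ circuitElements)
  φ = record
    { to         = ιˡ
    ; to-∈       = λ x → x∉p⇒x∈∁p λ x∈ → let y , _ , eq = ∈⟦⟧⁻ (∈image? ιʳ ⊤) x∈ in
                     ↑ˡ≢↑ʳ x y (sym eq)
    ; injective  = ιˡ-injective _ _
    ; surjective = λ {z} → preimage-of z
    }
    where
    preimage-of : ∀ z → z ∈ ∁ circuitElements → ∃[ x ] ιˡ x ≡ z
    preimage-of z z∈ = by (splitView n m′ z) z∈
      where
      by : ∀ {z} → SplitView n m′ z → z ∈ ∁ circuitElements → ∃[ x ] ιˡ x ≡ z
      by (left  x) _  = x , refl
      by (right y) z∈ = contradiction (∈⟦⟧⁺ (∈image? ιʳ ⊤) (y , ∈⊤ , refl)) (x∈∁p⇒x∉p z∈)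

  -- The lift as a deletion, and `M` as the contraction.

  lift : Matroid n
  lift = delete P circuitElements φ

  partˡ-image : ∀ A → partˡ (image ιˡ A) ≡ A
  partˡ-image = preimage-image ιˡ ιˡ-injective

  partʳ-image : ∀ A → partʳ (image ιˡ A) ≡ ⊥
  partʳ-image = preimage-image-disjoint ιʳ ιˡ λ y x → ↑ˡ≢↑ʳ x y ∘ sym

  rank-lift : ∀ A → rank lift A ≡ rank M A + rank N (𝒞 A)
  rank-lift A = trans (cong₂ ρ (partˡ-image A) (partʳ-image A))
    (cong (λ G → rank M A + rank N G) (∪-identityʳ (𝒞 A)))

  rankᴾ-circuitElements : rankᴾ circuitElements ≡ r N
  rankᴾ-circuitElements = trans
    (cong₂ ρ (preimage-image-disjoint ιˡ ιʳ ↑ˡ≢↑ʳ ⊤) (preimage-image ιʳ ιʳ-injective ⊤))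
    (trans (ρ-⊤ ⊥) (cong (_+ r N) (rank-⊥ M)))

  rankᴾ-image-∪ : ∀ A → rankᴾ (image ιˡ A ∪ circuitElements) ≡ rank M A + r N
  rankᴾ-image-∪ A = trans (cong₂ ρ
    (trans (preimage-∪ ιˡ (image ιˡ A) circuitElements) (trans
      (cong₂ _∪_ (partˡ-image A) (preimage-image-disjoint ιˡ ιʳ ↑ˡ≢↑ʳ ⊤)) (∪-identityʳ A)))
    (trans (preimage-∪ ιʳ (image ιˡ A) circuitElements) (trans
      (cong₂ _∪_ (partʳ-image A) (preimage-image ιʳ ιʳ-injective ⊤)) (∪-identityˡ ⊤))))
    (ρ-⊤ A)

  -- Once all of E(N) is present, the `N` summand is `r N` whatever `A` is, and the contraction
  -- subtracts exactly that.
  contract≈M : contract P circuitElements φ ≈ M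
  contract≈M A = trans (cong₂ _∸_ (rankᴾ-image-∪ A) rankᴾ-circuitElements) (m+n∸n≡m (rank M A) (r N))

  isRankLift : IsRankLift (r N) lift M
  isRankLift = (_ , P , circuitElements , φ , (λ _ → refl) , contract≈M)
    -- Every circuit lies in the full ground set, so `𝒞 ⊤` is all of E(N).
    , trans (rank-lift ⊤) (cong (λ G → r M + rank N G)
        (⊆-antisym ⊆⊤ λ _ → ∈circuits∣⁺ M ⊤ ⊆⊤))

theorem1p2 : ∀ {n : ℕ} (M : Matroid n) (N : Matroid (#circuits M)) →
    (∀ (𝒞 : Subset (#circuits M)) → Perfect M 𝒞 → ∀ i → circuit M i ⊆ ⋃ᶜ M 𝒞 → i ∈ cl N 𝒞) →
    Σ[ Mᴺ ∈ Matroid n ]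
    (∀ (X : Subset n) → rank Mᴺ X ≡ rank M X + rank N (circuits∣ M X)) × IsRankLift (r N) Mᴺ M
theorem1p2 M N perfect⇒spans = C.lift , C.rank-lift , C.isRankLift
  where module C = Construction M N perfect⇒spans
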